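{- Let $n\ge 3$ be odd. Then $K^*_n$ has a rotationally symmetric (r.s.) nomadic near-Hamiltonian decomposition: there is a partition of the arc set of $K^*_n$ (with vertex set $\mathbb{Z}_n$) into $n$ directed cycles $C_1,\dots,C_n$, each of length $n-1$, together with a choice of root vertex $v_i$ on each $C_i$, such that, writing $g_i(t)=v_i^{+t}$ for the position of the nomad on $C_i$ at time $t$, for every pair $i\neq j$ there is a constant $c_{ij}\not\equiv 0 \pmod n$ with $g_i(t)-g_j(t)\equiv c_{ij}\pmod n$ for all integers $t\ge 0$. In particular $v_i^{+t}\neq v_j^{+t}$ for all $i\ne j$ and all $t\ge 0$. -}

module Defs where

open import Data.Fin.Base using (Fin; toℕ)
open import Data.Integer.Base using (ℤ; +_; 0ℤ; _-_)
open import Data.Integer.Divisibility.Signed using (_∣_)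
open import Data.Nat.Base using (ℕ; suc; _≤_; _∸_)
open import Data.Nat.DivMod using (_mod_)
open import Data.Nat.GeneralisedArithmetic using (fold)
open import Data.Product using (Σ; ∃-syntax; ∃!; _×_; _,_; proj₁)
open import Function.Definitions using (Injective)
open import Level using (0ℓ)
open import Relation.Binary.Core using (Rel)
open import Relation.Binary.PropositionalEquality using (_≡_; _≢_; refl)
open import Relation.Nullary.Negation using (¬_)

infix 4 _≡_[mod_] _≢_[mod_]

_≡_[mod_] : ℤ → ℤ → ℕ → Set
a ≡ b [mod n ] = + n ∣ a - b

_≢_[mod_] : ℤ → ℤ → ℕ → Set
a ≢ b [mod n ] = ¬ (a ≡ b [mod n ])

-- A digraph without multiple arcs is given by its adjacency relation.
Digraph : Set → Set₁
Digraph V = Rel V 0ℓ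

-- The vertex set ℤₙ is represented by the residues 0, …, n - 1.
K* : (n : ℕ) → Digraph (Fin n)
K* n u v = u ≢ v

-- k ↦ k + 1 modulo m
next : ∀ {m} → Fin m → Fin m
next {suc m} k = suc (toℕ k) mod suc m

-- The enumeration of the vertices fixes a starting point, which plays no
-- role below: roots are chosen separately.
record DirectedCycle {V : Set} (E : Digraph V) (length : ℕ) : Set where
  field
    nonEmpty  : 1 ≤ length
    vertex    : Fin length → V
    injective : Injective _≡_ _≡_ vertex
    adjacent  : ∀ k → E (vertex k) (vertex (next k))

  Arc : Rel V 0ℓ
  Arc u v = ∃[ k ] (vertex k ≡ u × vertex (next k) ≡ v)

  OnCycle : V → Set
  OnCycle v = ∃[ k ] vertex k ≡ v

  VertexOn : Set
  VertexOn = Σ V OnCycle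

  successor : VertexOn → VertexOn
  successor (_ , k , _) = vertex (next k) , next k , refl

  -- v ⁺ t is the vertex reached from v after t steps along the cycle.
  _⁺_ : VertexOn → ℕ → V
  v ⁺ t = proj₁ (fold v successor t)

-- Every arc of a cycle is an arc of E by `adjacent`.
record CycleDecomposition {V : Set} (E : Digraph V) (count length : ℕ) : Set where
  field
    cycle     : Fin count → DirectedCycle E length
    partition : ∀ {u v} → E u v → ∃! _≡_ (λ i → DirectedCycle.Arc (cycle i) u v)

NearHamiltonianDecomposition : ℕ → Set
NearHamiltonianDecomposition n = CycleDecomposition (K* n) n (n ∸ 1)

module _ {n : ℕ} (D : NearHamiltonianDecomposition n) where
  open CycleDecomposition D

  Roots : Set
  Roots = ∀ i → DirectedCycle.VertexOn (cycle i)

  position : Roots → Fin n → ℕ → Fin n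
  position root i t = DirectedCycle._⁺_ (cycle i) (root i) t

  RotationallySymmetric : Roots → Set
  RotationallySymmetric root =
    ∀ i j → i ≢ j →
    ∃[ c ] (c ≢ 0ℤ [mod n ] ×
      (∀ t → + toℕ (position root i t) - + toℕ (position root j t) ≡ c [mod n ]))

  Nomadic : Roots → Set
  Nomadic root = ∀ i j → i ≢ j → ∀ t → position root i t ≢ position root j t

{-# OPTIONS --safe #-}

-- Translating one closed walk c of length n - 1 by all residues decomposes K*ₙ
-- as soon as the vertices of c are distinct and its gaps c (next k) - c k
-- represent every nonzero residue: an arc u → v lies on the translate by
-- u - c k for the unique k with gap v - u. Nomads starting at the same index
-- keep constant differences i - j. For n = 2 m + 1 the walk is the zigzag
--   0, 2m - 1, 2, 2m - 3, 4, …, 1,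
-- in which the even entries jump by 4 instead of 2 when they pass m. Its gaps
-- are, as integers, the odd numbers strictly between -2m and 2m, and these
-- represent the nonzero residues modulo 2 m + 1.
module Submission where

open import Defs
open import Data.Fin.Base using (Fin; zero; suc; toℕ; fromℕ<; punchOut)
open import Data.Fin.Properties as Fin
  using (toℕ-injective; toℕ-fromℕ<; toℕ<n; punchOut-injective; injective⇒≤; any?)
open import Data.Integer.Base as ℤ using (ℤ; +_; 0ℤ; ∣_∣)
open import Data.Integer.Divisibility.Signed
  using (_∣_; divides; ∣⇒∣ᵤ; ∣m∣n⇒∣m+n; ∣m∣n⇒∣m-n; ∣m⇒∣-m)
open import Data.Integer.DivMod using (_%ℕ_; _/ℕ_; n%ℕd<d; a≡a%ℕn+[a/ℕn]*n)
import Data.Integer.Properties as ℤ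
import Data.Integer.Tactic.RingSolver as ℤ-Solver
open import Data.Nat.Base
  using (ℕ; zero; suc; _+_; _*_; _∸_; _⊔_; _≤_; _<_; _%_; _/_; z≤n; s≤s; z<s; s≤s⁻¹)
open import Data.Nat.Divisibility as ℕ using (∣⇒≤)
open import Data.Nat.DivMod using (m≡m%n+[m/n]*n; m*n%n≡0; [m+kn]%n≡m%n; m<n⇒m%n≡m; n%n≡0)
open import Data.Nat.GeneralisedArithmetic using (fold)
open import Data.Nat.Properties
open import Data.Nat.Tactic.RingSolver using (solve-∀)
open import Data.Product using (Σ-syntax; ∃-syntax; _×_; _,_; proj₁; proj₂)
open import Data.Sum.Base using (_⊎_; inj₁; inj₂)
open import Function.Definitions using (Injective)
open import Relation.Binary.PropositionalEquality
  using (_≡_; _≢_; refl; sym; trans; cong; cong₂; subst; module ≡-Reasoning)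
open import Relation.Nullary.Decidable using (yes; no)
open import Relation.Nullary.Negation using (contradiction)

-- Congruences and residues

infix 4 _≋_[mod_]

-- A record, so that the terms and the modulus can be inferred from a
-- congruence; a ≡ b [mod n ] unfolds to a divisibility that forgets a and b.
record _≋_[mod_] (a b : ℤ) (n : ℕ) : Set where
  constructor mod
  field congruence : a ≡ b [mod n ]

open _≋_[mod_]

≋-resp : ∀ {n a b c d} → a ℤ.- b ≡ c ℤ.- d → a ≋ b [mod n ] → c ≋ d [mod n ]
≋-resp {n} eq (mod p) = mod (subst (+ n ∣_) eq p)

≋-reflexive : ∀ {n a b} → a ≡ b → a ≋ b [mod n ]
≋-reflexive {n} {a} refl = mod (divides 0ℤ (ℤ.+-inverseʳ a))

≋-sym : ∀ {n a b} → a ≋ b [mod n ] → b ≋ a [mod n ]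
≋-sym {n} {a} {b} (mod p) = mod (subst (+ n ∣_) (lemma a b) (∣m⇒∣-m p))
  where
  lemma : ∀ a b → ℤ.- (a ℤ.- b) ≡ b ℤ.- a
  lemma = ℤ-Solver.solve-∀

≋-trans : ∀ {n a b c} → a ≋ b [mod n ] → b ≋ c [mod n ] → a ≋ c [mod n ]
≋-trans {n} {a} {b} {c} (mod p) (mod q) = mod (subst (+ n ∣_) (lemma a b c) (∣m∣n⇒∣m+n p q))
  where
  lemma : ∀ a b c → (a ℤ.- b) ℤ.+ (b ℤ.- c) ≡ a ℤ.- c
  lemma = ℤ-Solver.solve-∀

≋-minus : ∀ {n a b c d} → a ≋ b [mod n ] → c ≋ d [mod n ] → a ℤ.- c ≋ b ℤ.- d [mod n ]
≋-minus {n} {a} {b} {c} {d} (mod p) (mod q) = mod (subst (+ n ∣_) (lemma a b c d) (∣m∣n⇒∣m-n p q))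
  where
  lemma : ∀ a b c d → (a ℤ.- b) ℤ.- (c ℤ.- d) ≡ (a ℤ.- c) ℤ.- (b ℤ.- d)
  lemma = ℤ-Solver.solve-∀

≋-plus : ∀ {n a b c d} → a ≋ b [mod n ] → c ≋ d [mod n ] → a ℤ.+ c ≋ b ℤ.+ d [mod n ]
≋-plus {n} {a} {b} {c} {d} (mod p) (mod q) = mod (subst (+ n ∣_) (lemma a b c d) (∣m∣n⇒∣m+n p q))
  where
  lemma : ∀ a b c d → (a ℤ.- b) ℤ.+ (c ℤ.- d) ≡ (a ℤ.+ c) ℤ.- (b ℤ.+ d)
  lemma = ℤ-Solver.solve-∀

-- Two representatives below `n` differ by less than `n` in absolute value, and no positive multiple
-- of `n` is that small.
≋⇒≡ : ∀ {n} {x y : Fin n} → + toℕ x ≋ + toℕ y [mod n ] → x ≡ y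
≋⇒≡ {n} {x} {y} (mod p) = toℕ-injective (ℤ.+-injective (ℤ.i-j≡0⇒i≡j _ _ (ℤ.∣i∣≡0⇒i≡0 (distance≡0 _ refl))))
  where
  distance<n : ∣ + toℕ x ℤ.- + toℕ y ∣ < n
  distance<n = ≤-<-trans
    (subst (λ z → ∣ z ∣ ≤ toℕ x ⊔ toℕ y) (sym (ℤ.m-n≡m⊖n (toℕ x) (toℕ y))) (ℤ.∣m⊝n∣≤m⊔n (toℕ x) (toℕ y)))
    (⊔-lub (toℕ<n x) (toℕ<n y))

  distance≡0 : ∀ d → ∣ + toℕ x ℤ.- + toℕ y ∣ ≡ d → ∣ + toℕ x ℤ.- + toℕ y ∣ ≡ 0
  distance≡0 zero    eq = eq
  distance≡0 (suc d) eq = contradiction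
    (∣⇒≤ (subst (n ℕ.∣_) eq (∣⇒∣ᵤ p))) (<⇒≱ (subst (_< n) eq distance<n))

-- Sealed so that integer division does not unfold in later goals, which use `residue` only through
-- `toℕ-residue`.
abstract
  residue : ∀ {n} → ℤ → Fin (suc n)
  residue {n} a = fromℕ< (n%ℕd<d a (suc n))

  toℕ-residue : ∀ {n} a → + toℕ (residue {n} a) ≋ a [mod suc n ]
  toℕ-residue {n} a = ≋-sym (mod (divides (a /ℕ suc n) (begin
    a ℤ.- + toℕ (residue {n} a)                  ≡⟨ cong (λ r → a ℤ.- + r) (toℕ-fromℕ< (n%ℕd<d a (suc n))) ⟩
    a ℤ.- + r                                    ≡⟨ cong (ℤ._- + r) (a≡a%ℕn+[a/ℕn]*n a (suc n)) ⟩
    (+ r ℤ.+ (a /ℕ suc n) ℤ.* + suc n) ℤ.- + r   ≡⟨ lemma (+ r) _ ⟩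
    (a /ℕ suc n) ℤ.* + suc n                     ∎)))
    where
    open ≡-Reasoning
    r : ℕ
    r = a %ℕ suc n
    lemma : ∀ x y → (x ℤ.+ y) ℤ.- x ≡ y
    lemma = ℤ-Solver.solve-∀

-- Lets gaps be checked by equations in ℕ: the first alternative is a rise by `d`, the second a fall
-- by `n - d`.
difference-≋ : ∀ {n} a b d → b ≡ a + d ⊎ b + n ≡ a + d → + b ℤ.- + a ≋ + d [mod n ]
difference-≋ a _ d (inj₁ refl) =
  ≋-reflexive (trans (cong (ℤ._- + a) (ℤ.pos-+ a d)) (lemma (+ a) (+ d)))
  where
  lemma : ∀ x y → (x ℤ.+ y) ℤ.- x ≡ y
  lemma = ℤ-Solver.solve-∀
difference-≋ {n} a b d (inj₂ eq) = mod (divides ℤ.-1ℤ (begin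
  (+ b ℤ.- + a) ℤ.- + d                       ≡⟨ lemma (+ a) (+ b) (+ d) (+ n) ⟩
  ((+ b ℤ.+ + n) ℤ.- (+ a ℤ.+ + d)) ℤ.- + n   ≡⟨ cong (ℤ._- + n) (ℤ.i≡j⇒i-j≡0 b+n≡a+d) ⟩
  0ℤ ℤ.- + n                                  ≡⟨ ℤ.+-identityˡ (ℤ.- + n) ⟩
  ℤ.- + n                                     ≡⟨ ℤ.-1*i≡-i (+ n) ⟨
  ℤ.-1ℤ ℤ.* + n                               ∎))
  where
  open ≡-Reasoning
  b+n≡a+d : + b ℤ.+ + n ≡ + a ℤ.+ + d
  b+n≡a+d = trans (sym (ℤ.pos-+ b n)) (trans (cong +_ eq) (ℤ.pos-+ a d))
  lemma : ∀ a b d n → (b ℤ.- a) ℤ.- d ≡ ((b ℤ.+ n) ℤ.- (a ℤ.+ d)) ℤ.- n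
  lemma = ℤ-Solver.solve-∀

-- Finite sets and the cyclic successor

-- Pigeonhole: if `y` were missed, punching it out of the codomain would inject `suc n` elements
-- into `n`.
injective⇒surjective : ∀ {n} {f : Fin n → Fin n} → Injective _≡_ _≡_ f → ∀ y → ∃[ x ] f x ≡ y
injective⇒surjective {suc n} {f} f-injective y with any? (λ x → f x Fin.≟ y)
... | yes hit = hit
... | no ¬hit = contradiction
  (injective⇒≤ {f = λ x → punchOut (y≢f x)} λ eq → f-injective (punchOut-injective (y≢f _) (y≢f _) eq))
  1+n≰n
  where
  y≢f : ∀ x → y ≢ f x
  y≢f x eq = ¬hit (x , sym eq)

toℕ-next : ∀ {n} (k : Fin n) → suc (toℕ k) < n → toℕ (next k) ≡ suc (toℕ k)
toℕ-next {suc n} k k+1<n = trans (toℕ-fromℕ< _) (m<n⇒m%n≡m k+1<n)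

toℕ-next-last : ∀ {n} (k : Fin n) → suc (toℕ k) ≡ n → toℕ (next k) ≡ 0
toℕ-next-last {suc n} k k+1≡n = trans (toℕ-fromℕ< _) (trans (cong (_% suc n) k+1≡n) (n%n≡0 (suc n)))

-- Excludes loops from the translated walks. At the wrap to 0, `2 ≤ n` ensures that the last index
-- is not itself 0.
next≢ : ∀ {n} → 2 ≤ n → (k : Fin n) → next k ≢ k
next≢ 2≤n k eq with m≤n⇒m<n∨m≡n (toℕ<n k)
... | inj₁ k+1<n = 1+n≢n (trans (sym (toℕ-next k k+1<n)) (cong toℕ eq))
... | inj₂ k+1≡n = <⇒≢ (s≤s⁻¹ (subst (2 ≤_) (sym k+1≡n) 2≤n))
  (trans (sym (toℕ-next-last k k+1≡n)) (cong toℕ eq))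

-- Decomposition and nomads from the translates of one closed walk

module Development {ℓ} (2≤ℓ : 2 ≤ ℓ) (base : Fin ℓ → ℤ)
  (base-injective : ∀ {k k′} → base k ≋ base k′ [mod suc ℓ ] → k ≡ k′)
  -- `suc (toℕ d)` runs through 1, ..., `ℓ`, the nonzero residues; there are as many of them as
  -- indices.
  (gap-onto : ∀ d → ∃[ k ] base (next k) ℤ.- base k ≋ + suc (toℕ {ℓ} d) [mod suc ℓ ])
  where

  private n = suc ℓ

  gap : Fin ℓ → ℤ
  gap k = base (next k) ℤ.- base k

  gap⁻¹ : Fin ℓ → Fin ℓ
  gap⁻¹ d = proj₁ (gap-onto d)

  gap⁻¹-injective : Injective _≡_ _≡_ gap⁻¹
  gap⁻¹-injective {d} {d′} eq = Fin.suc-injective (≋⇒≡ (≋-trans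
    (≋-sym (proj₂ (gap-onto d)))
    (subst (λ k → gap k ≋ + suc (toℕ d′) [mod n ]) (sym eq) (proj₂ (gap-onto d′)))))

  -- There are as many gaps as nonzero residues, so gaps hitting all of them
  -- are distinct.
  gap-injective : ∀ {k k′} → gap k ≋ gap k′ [mod n ] → k ≡ k′
  gap-injective {k} {k′} p
    with d , refl ← injective⇒surjective gap⁻¹-injective k
       | d′ , refl ← injective⇒surjective gap⁻¹-injective k′
    = cong gap⁻¹ (Fin.suc-injective (≋⇒≡ (≋-trans
        (≋-sym (proj₂ (gap-onto d))) (≋-trans p (proj₂ (gap-onto d′))))))

  gap-hits : ∀ {u v : Fin n} → u ≢ v → ∃[ k ] gap k ≋ + toℕ v ℤ.- + toℕ u [mod n ]
  gap-hits {u} {v} u≢v = hit (residue (+ toℕ v ℤ.- + toℕ u)) (toℕ-residue _)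
    where
    hit : (d : Fin n) → + toℕ d ≋ + toℕ v ℤ.- + toℕ u [mod n ] →
          ∃[ k ] gap k ≋ + toℕ v ℤ.- + toℕ u [mod n ]
    -- Residue 0 would make the two ends of the arc equal.
    hit zero    p = contradiction (sym (≋⇒≡ (≋-resp (ℤ.+-identityʳ _) (≋-sym p)))) u≢v
    hit (suc d) p = gap⁻¹ d , ≋-trans (proj₂ (gap-onto d)) p

  vertex : Fin n → Fin ℓ → Fin n
  vertex i k = residue (+ toℕ i ℤ.+ base k)

  toℕ-vertex : ∀ i k → + toℕ (vertex i k) ≋ + toℕ i ℤ.+ base k [mod n ]
  toℕ-vertex i k = toℕ-residue (+ toℕ i ℤ.+ base k)

  vertex-injective : ∀ i → Injective _≡_ _≡_ (vertex i)
  vertex-injective i {k} {k′} eq = base-injective (≋-resp (lemma (+ toℕ i) (base k) (base k′))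
    (≋-trans (≋-sym (toℕ-vertex i k))
      (subst (λ x → + toℕ x ≋ + toℕ i ℤ.+ base k′ [mod n ]) (sym eq) (toℕ-vertex i k′))))
    where
    lemma : ∀ i a b → (i ℤ.+ a) ℤ.- (i ℤ.+ b) ≡ a ℤ.- b
    lemma = ℤ-Solver.solve-∀

  translate : Fin n → DirectedCycle (K* n) ℓ
  translate i = record
    { nonEmpty  = ≤-trans (s≤s z≤n) 2≤ℓ
    ; vertex    = vertex i
    ; injective = vertex-injective i
    ; adjacent  = λ k eq → next≢ 2≤ℓ k (sym (vertex-injective i eq))
    }

  vertex-difference : ∀ i j k →
    + toℕ (vertex i k) ℤ.- + toℕ (vertex j k) ≋ + toℕ i ℤ.- + toℕ j [mod n ]
  vertex-difference i j k = ≋-trans (≋-minus (toℕ-vertex i k) (toℕ-vertex j k))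
    (≋-reflexive (lemma (+ toℕ i) (+ toℕ j) (base k)))
    where
    lemma : ∀ i j b → (i ℤ.+ b) ℤ.- (j ℤ.+ b) ≡ i ℤ.- j
    lemma = ℤ-Solver.solve-∀

  arc-gap : ∀ i k → + toℕ (vertex i (next k)) ℤ.- + toℕ (vertex i k) ≋ gap k [mod n ]
  arc-gap i k = ≋-trans (≋-minus (toℕ-vertex i (next k)) (toℕ-vertex i k))
    (≋-reflexive (lemma (+ toℕ i) (base (next k)) (base k)))
    where
    lemma : ∀ i a b → (i ℤ.+ a) ℤ.- (i ℤ.+ b) ≡ a ℤ.- b
    lemma = ℤ-Solver.solve-∀

  vertex-cancelʳ : ∀ {i j} k → vertex i k ≡ vertex j k → i ≡ j
  vertex-cancelʳ {i} {j} k eq = ≋⇒≡ (≋-resp (lemma (+ toℕ i) (+ toℕ j) (base k))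
    (≋-trans (≋-sym (toℕ-vertex i k))
      (subst (λ x → + toℕ x ≋ + toℕ j ℤ.+ base k [mod n ]) (sym eq) (toℕ-vertex j k))))
    where
    lemma : ∀ i j b → (i ℤ.+ b) ℤ.- (j ℤ.+ b) ≡ i ℤ.- j
    lemma = ℤ-Solver.solve-∀

  arc-exists : ∀ {u v} → u ≢ v → ∃[ i ] DirectedCycle.Arc (translate i) u v
  arc-exists {u} {v} u≢v with k , p ← gap-hits u≢v =
    i , k , ≋⇒≡ start , ≋⇒≡ end
    where
    -- Solves `i + base k ≡ u`, so that the arc at index `k` starts at `u`.
    i = residue (+ toℕ u ℤ.- base k)

    start : + toℕ (vertex i k) ≋ + toℕ u [mod n ]
    start = ≋-trans (toℕ-vertex i k)
      (≋-resp (lemma (+ toℕ i) (+ toℕ u) (base k)) (toℕ-residue (+ toℕ u ℤ.- base k)))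
      where
      lemma : ∀ i u b → i ℤ.- (u ℤ.- b) ≡ (i ℤ.+ b) ℤ.- u
      lemma = ℤ-Solver.solve-∀

    end : + toℕ (vertex i (next k)) ≋ + toℕ v [mod n ]
    -- The difference `v - u` along the arc is added to its start `u`.
    end = ≋-resp (lemma (+ toℕ (vertex i (next k))) (+ toℕ (vertex i k)) (+ toℕ v) (+ toℕ u))
      (≋-plus (≋-trans (arc-gap i k) p) start)
      where
      lemma : ∀ y x v u → ((y ℤ.- x) ℤ.+ x) ℤ.- ((v ℤ.- u) ℤ.+ u) ≡ y ℤ.- v
      lemma = ℤ-Solver.solve-∀

  -- Translation leaves the gap of an arc unchanged, and the gap determines the index.
  same-arc⇒same-index : ∀ {i j} k k′ → vertex j k′ ≡ vertex i k →
                        vertex j (next k′) ≡ vertex i (next k) → k′ ≡ k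
  same-arc⇒same-index {i} {j} k k′ start end = gap-injective (≋-trans (≋-sym (arc-gap j k′))
    (≋-trans (≋-reflexive (cong₂ (λ y x → + toℕ y ℤ.- + toℕ x) end start)) (arc-gap i k)))

  arc-unique : ∀ {u v i j} → DirectedCycle.Arc (translate i) u v →
               DirectedCycle.Arc (translate j) u v → i ≡ j
  arc-unique {i = i} {j} (k , start , end) (k′ , start′ , end′) =
    vertex-cancelʳ k (trans start (trans (sym start′) (cong (vertex j) k′≡k)))
    where
    k′≡k : k′ ≡ k
    k′≡k = same-arc⇒same-index k k′ (trans start′ (sym start)) (trans end′ (sym end))

  decomposition : NearHamiltonianDecomposition n
  decomposition = record
    { cycle     = translate
    ; partition = λ u≢v → let i , arc = arc-exists u≢v in i , arc , arc-unique arc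
    }

  origin : Fin ℓ
  origin = fromℕ< (≤-trans (s≤s z≤n) 2≤ℓ)

  roots : Roots decomposition
  roots i = vertex i origin , origin , refl

  -- The index reached at time `t` does not depend on `i`, so two nomads always differ as their
  -- translations do.
  position≡vertex : ∀ i t → position decomposition roots i t ≡ vertex i (fold origin next t)
  position≡vertex i t = cong proj₁ (walk t)
    where
    open DirectedCycle (translate i) using (successor)
    -- The induction carries the whole triple, because `successor` reads the index and not the
    -- vertex.
    walk : ∀ t → fold (roots i) successor t ≡ (vertex i (fold origin next t) , fold origin next t , refl)
    walk zero    = refl
    walk (suc t) = cong successor (walk t)

  rotationallySymmetric : RotationallySymmetric decomposition roots
  rotationallySymmetric i j i≢j = + toℕ i ℤ.- + toℕ j , c≢0 , difference
    where
    c≢0 : + toℕ i ℤ.- + toℕ j ≢ 0ℤ [mod n ]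
    c≢0 p = i≢j (≋⇒≡ (mod (subst (+ n ∣_) (ℤ.+-identityʳ _) p)))

    difference : ∀ t → + toℕ (position decomposition roots i t) ℤ.- + toℕ (position decomposition roots j t)
                       ≡ + toℕ i ℤ.- + toℕ j [mod n ]
    difference t rewrite position≡vertex i t | position≡vertex j t =
      congruence (vertex-difference i j (fold origin next t))

  nomadic : Nomadic decomposition roots
  nomadic i j i≢j t eq = i≢j (vertex-cancelʳ (fold origin next t)
    (trans (sym (position≡vertex i t)) (trans eq (position≡vertex j t))))

-- The zigzag

-- Doubles are written `j * 2` because `suc j * 2` computes to `suc (suc (j * 2))`.
halve : ∀ k → (∃[ j ] k ≡ j * 2) ⊎ (∃[ j ] k ≡ suc (j * 2))
halve zero = inj₁ (0 , refl)
halve (suc k) with halve k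
... | inj₁ (j , refl) = inj₂ (j , refl)
... | inj₂ (j , refl) = inj₁ (suc j , refl)

even≢odd′ : ∀ a b → a * 2 ≢ suc (b * 2)
even≢odd′ a b eq = even≢odd a b (trans (*-comm 2 a) (trans eq (cong suc (*-comm b 2))))

-- Odd indices run down through the odd numbers below `2m`, even indices up through the even numbers
-- from 0 to `2m`. The one even number skipped, the least that is at least `m`, is the vertex missed
-- by the untranslated cycle.
zigzag : ℕ → ℕ → ℕ
zigzag m k with k % 2
... | suc _ = m * 2 ∸ k
... | zero with k <? m
...   | yes _ = k
...   | no  _ = 2 + k

zigzag-low : ∀ m j → j * 2 < m → zigzag m (j * 2) ≡ j * 2
zigzag-low m j k<m rewrite m*n%n≡0 j 2 {{_}} with j * 2 <? m
... | yes _   = refl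
... | no  k≮m = contradiction k<m k≮m

zigzag-high : ∀ m j → m ≤ j * 2 → zigzag m (j * 2) ≡ suc j * 2
zigzag-high m j m≤k rewrite m*n%n≡0 j 2 {{_}} with j * 2 <? m
... | yes k<m = contradiction m≤k (<⇒≱ k<m)
... | no  _   = refl

zigzag-odd : ∀ m j r → suc j + r ≡ m → zigzag m (suc (j * 2)) ≡ suc (r * 2)
zigzag-odd m j r refl rewrite [m+kn]%n≡m%n 1 j 2 {{_}} =
  trans (cong (_∸ suc (j * 2)) (lemma j r)) (m+n∸m≡n (suc (j * 2)) (suc (r * 2)))
  where
  lemma : ∀ j r → (suc j + r) * 2 ≡ suc (j * 2) + suc (r * 2)
  lemma = solve-∀

-- In `odd`, `r` stands for `m - 1 - j`, which gives the value `2m - (2j + 1)` as `2r + 1` without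
-- truncated subtraction.
data ZigzagView (m : ℕ) : ℕ → ℕ → Set where
  low  : ∀ j → j * 2 < m → ZigzagView m (j * 2) (j * 2)
  high : ∀ j → m ≤ j * 2 → j < m → ZigzagView m (j * 2) (suc j * 2)
  odd  : ∀ j r → suc j + r ≡ m → ZigzagView m (suc (j * 2)) (suc (r * 2))

zigzag-view : ∀ m k → k < m * 2 → ZigzagView m k (zigzag m k)
zigzag-view m k k<2m with halve k
... | inj₁ (j , refl) with j * 2 <? m
...   | yes k<m rewrite zigzag-low m j k<m = low j k<m
...   | no  k≮m rewrite zigzag-high m j (≮⇒≥ k≮m) = high j (≮⇒≥ k≮m) (*-cancelʳ-< 2 j m k<2m)
zigzag-view m k k<2m | inj₂ (j , refl)
  with r , eq ← m≤n⇒∃[o]m+o≡n (*-cancelʳ-< 2 j m (<-trans (n<1+n (j * 2)) k<2m))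
  rewrite zigzag-odd m j r eq = odd j r eq

-- Keeps the values below the modulus `2m + 1`, where congruence is equality.
view-bounded : ∀ {m k v} → ZigzagView m k v → v ≤ m * 2
view-bounded {m} (low j j<m)      = ≤-trans (<⇒≤ j<m) (m≤m*n m 2)
view-bounded     (high j _ j<m)   = *-monoˡ-≤ 2 j<m
view-bounded     (odd j r refl)   = m+n≤o⇒m≤o (suc (r * 2)) (≤-reflexive (lemma j r))
  where
  lemma : ∀ j r → suc (r * 2) + suc (j * 2) ≡ (suc j + r) * 2
  lemma = solve-∀

-- Parity separates `odd` from the rest, `low` values lie below `m` and `high` values above it, and
-- within one branch the value determines the index.
view-injective : ∀ {m k k′ v v′} → ZigzagView m k v → ZigzagView m k′ v′ → v ≡ v′ → k ≡ k′
view-injective (low _ _)    (low _ _)       eq = eq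
view-injective {m} (low j k<m) (high i m≤k _) eq =
  contradiction (≤-trans m≤k (m≤n+m (i * 2) 2)) (<⇒≱ (subst (_< m) eq k<m))
view-injective (low j _)    (odd _ r _)     eq = contradiction eq (even≢odd′ j r)
view-injective {m} (high i m≤k _) (low j k<m) eq =
  contradiction (≤-trans m≤k (m≤n+m (i * 2) 2)) (<⇒≱ (subst (_< m) (sym eq) k<m))
view-injective (high _ _ _) (high _ _ _)    eq = suc-injective (suc-injective eq)
view-injective (high j _ _) (odd _ r _)     eq = contradiction eq (even≢odd′ (suc j) r)
view-injective (odd _ r _)  (low j _)       eq = contradiction (sym eq) (even≢odd′ j r)
view-injective (odd _ r _)  (high j _ _)    eq = contradiction (sym eq) (even≢odd′ (suc j) r)
view-injective (odd j r p)  (odd j′ r′ p′)  eq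
  with refl ← *-cancelʳ-≡ r r′ 2 (suc-injective eq)
  with refl ← +-cancelʳ-≡ r (suc j) (suc j′) (trans p (sym p′)) = refl

-- Gaps of the zigzag modulo 2m + 1

module _ (m : ℕ) where

  zigzagℤ : Fin (m * 2) → ℤ
  zigzagℤ k = + zigzag m (toℕ k)

  zigzagℤ-injective : ∀ {k k′} → zigzagℤ k ≋ zigzagℤ k′ [mod suc (m * 2) ] → k ≡ k′
  zigzagℤ-injective {k} {k′} p =
    toℕ-injective (view-injective (view k) (view k′) (begin
      zigzag m (toℕ k)    ≡⟨ toℕ-fromℕ< (bound k) ⟨
      toℕ (value k)       ≡⟨ cong toℕ (≋⇒≡ {x = value k} {value k′} values≡) ⟩
      toℕ (value k′)      ≡⟨ toℕ-fromℕ< (bound k′) ⟩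
      zigzag m (toℕ k′)   ∎))
    where
    open ≡-Reasoning
    view : ∀ k → ZigzagView m (toℕ k) (zigzag m (toℕ k))
    view k = zigzag-view m (toℕ k) (toℕ<n k)

    bound : ∀ k → zigzag m (toℕ k) < suc (m * 2)
    bound k = s≤s (view-bounded (view k))

    value : Fin (m * 2) → Fin (suc (m * 2))
    value k = fromℕ< (bound k)

    values≡ : + toℕ (value k) ≋ + toℕ (value k′) [mod suc (m * 2) ]
    values≡ rewrite toℕ-fromℕ< (bound k) | toℕ-fromℕ< (bound k′) = p

  IsGap : ℕ → Set
  IsGap d = ∃[ k ] zigzagℤ (next k) ℤ.- zigzagℤ k ≋ + d [mod suc (m * 2) ]

  isGap-at : ∀ (k : Fin (m * 2)) {a b d} → zigzag m (toℕ k) ≡ a → zigzag m (toℕ (next k)) ≡ b →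
             b ≡ a + d ⊎ b + suc (m * 2) ≡ a + d → IsGap d
  isGap-at k {a} {b} {d} refl refl p = k , difference-≋ a b d p

  isGap-step : ∀ k {a b d} → suc k < m * 2 → zigzag m k ≡ a → zigzag m (suc k) ≡ b →
               b ≡ a + d ⊎ b + suc (m * 2) ≡ a + d → IsGap d
  isGap-step k k+1<2m refl refl = isGap-at k′ (cong (zigzag m) toℕ-k′) (cong (zigzag m) toℕ-next-k′)
    where
    k<2m = <-trans (n<1+n k) k+1<2m
    k′ = fromℕ< k<2m
    toℕ-k′ : toℕ k′ ≡ k
    toℕ-k′ = toℕ-fromℕ< k<2m
    toℕ-next-k′ : toℕ (next k′) ≡ suc k
    toℕ-next-k′ = trans (toℕ-next k′ (subst (λ x → suc x < m * 2) (sym toℕ-k′) k+1<2m)) (cong suc toℕ-k′)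

  isGap-last : ∀ k {a b d} → suc k ≡ m * 2 → zigzag m k ≡ a → zigzag m 0 ≡ b →
               b ≡ a + d ⊎ b + suc (m * 2) ≡ a + d → IsGap d
  isGap-last k k+1≡2m refl refl = isGap-at k′ (cong (zigzag m) toℕ-k′) (cong (zigzag m) toℕ-next-k′)
    where
    k<2m = ≤-reflexive k+1≡2m
    k′ = fromℕ< k<2m
    toℕ-k′ : toℕ k′ ≡ k
    toℕ-k′ = toℕ-fromℕ< k<2m
    toℕ-next-k′ : toℕ (next k′) ≡ 0
    toℕ-next-k′ = toℕ-next-last k′ (trans (cong suc toℕ-k′) k+1≡2m)

-- These are the rises. From a low index `2j` the rise is `2m - 1 - 4j`; from an odd index `2i + 1`
-- to a high one it is `4i + 5 - 2m`. Equating with `2r + 1` gives `2j = q` or `2i = 2r + q - 1`, so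
-- the parity of `q` selects the kind.
odd-isGap : ∀ m r q → suc (r + q) ≡ m → IsGap m (suc (r * 2))
odd-isGap m r q refl with halve q
... | inj₁ (j , refl) = isGap-step m (j * 2)
  (m+n≤o⇒m≤o (suc (suc (j * 2))) (≤-reflexive (lemma₁ j r)))
  (zigzag-low m j (s≤s (m≤n+m (j * 2) r)))
  (zigzag-odd m j (j + r) (lemma₂ j r))
  (inj₁ (lemma₃ j r))
  where
  lemma₁ : ∀ j r → suc (suc (j * 2)) + (r + r + j * 2) ≡ suc (r + j * 2) * 2
  lemma₁ = solve-∀
  lemma₂ : ∀ j r → suc j + (j + r) ≡ suc (r + j * 2)
  lemma₂ = solve-∀
  lemma₃ : ∀ j r → suc ((j + r) * 2) ≡ j * 2 + suc (r * 2)
  lemma₃ = solve-∀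
... | inj₂ (j , refl) = isGap-step m (suc ((j + r) * 2))
  (m+n≤o⇒m≤o (suc (suc (suc ((j + r) * 2)))) (≤-reflexive (lemma₁ j r)))
  (zigzag-odd m (j + r) (suc j) (lemma₂ j r))
  (zigzag-high m (suc (j + r)) (m+n≤o⇒m≤o (suc (r + suc (j * 2))) (≤-reflexive (lemma₃ j r))))
  (inj₁ (lemma₄ j r))
  where
  lemma₁ : ∀ j r → suc (suc (suc ((j + r) * 2))) + suc (j * 2) ≡ suc (r + suc (j * 2)) * 2
  lemma₁ = solve-∀
  lemma₂ : ∀ j r → suc (j + r) + suc j ≡ suc (r + suc (j * 2))
  lemma₂ = solve-∀
  lemma₃ : ∀ j r → suc (r + suc (j * 2)) + r ≡ suc (j + r) * 2
  lemma₃ = solve-∀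
  lemma₄ : ∀ j r → suc (suc (j + r)) * 2 ≡ suc (suc j * 2) + suc (r * 2)
  lemma₄ = solve-∀

-- Modulo `2m + 1` the residue `2(q + 1)` is `-(2r + 1)`, so a fall by `2r + 1` is sought.
even-isGap : ∀ m q r → suc (q + r) ≡ m → IsGap m (suc q * 2)
-- The fall by 1 is the closing arc, from value 1 at index `2m - 1` back to 0.
even-isGap m q zero refl = isGap-last m (suc (q * 2))
  (cong (λ x → suc x * 2) (sym (+-identityʳ q)))
  (zigzag-odd m q 0 refl)
  (zigzag-low m 0 z<s)
  (inj₂ (cong (λ x → suc (suc x * 2)) (+-identityʳ q)))
even-isGap m q (suc s) refl with halve q
-- A fall from a high index, from value `2(j + s + 2)` to `2j + 1`.
... | inj₁ (j , refl) = isGap-step m ((j + suc s) * 2)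
  (m+n≤o⇒m≤o (suc (suc ((j + suc s) * 2))) (≤-reflexive (lemma₁ j s)))
  (zigzag-high m (j + suc s) (m+n≤o⇒m≤o (suc (j * 2 + suc s)) (≤-reflexive (lemma₂ j s))))
  (zigzag-odd m (j + suc s) j (lemma₃ j s))
  (inj₂ (lemma₄ j s))
  where
  lemma₁ : ∀ j s → suc (suc ((j + suc s) * 2)) + j * 2 ≡ suc (j * 2 + suc s) * 2
  lemma₁ = solve-∀
  lemma₂ : ∀ j s → suc (j * 2 + suc s) + s ≡ (j + suc s) * 2
  lemma₂ = solve-∀
  lemma₃ : ∀ j s → suc (j + suc s) + j ≡ suc (j * 2 + suc s)
  lemma₃ = solve-∀
  lemma₄ : ∀ j s → suc (j * 2) + suc (suc (j * 2 + suc s) * 2) ≡ suc (j + suc s) * 2 + suc (j * 2) * 2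
  lemma₄ = solve-∀
-- A fall to a low index, from value `2(j + s + 2) + 1` to `2j + 2`.
... | inj₂ (j , refl) = isGap-step m (suc (j * 2))
  (m+n≤o⇒m≤o (suc (suc (suc (j * 2)))) (≤-reflexive (lemma₁ j s)))
  (zigzag-odd m j (2 + j + s) (lemma₂ j s))
  (zigzag-low m (suc j) (m+n≤o⇒m≤o (suc (suc j * 2)) (≤-reflexive (lemma₃ j s))))
  (inj₂ (lemma₄ j s))
  where
  lemma₁ : ∀ j s → suc (suc (suc (j * 2))) + suc (j * 2 + s + s + 2) ≡ suc (suc (j * 2) + suc s) * 2
  lemma₁ = solve-∀
  lemma₂ : ∀ j s → suc j + (2 + j + s) ≡ suc (suc (j * 2) + suc s)
  lemma₂ = solve-∀
  lemma₃ : ∀ j s → suc (suc j * 2) + s ≡ suc (suc (j * 2) + suc s)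
  lemma₃ = solve-∀
  lemma₄ : ∀ j s → suc j * 2 + suc (suc (suc (j * 2) + suc s) * 2)
                 ≡ suc ((2 + j + s) * 2) + suc (suc (j * 2)) * 2
  lemma₄ = solve-∀

nonzero-isGap : ∀ m d → d < m * 2 → IsGap m (suc d)
nonzero-isGap m d d<2m with halve d
... | inj₁ (r , refl) with q , eq ← m≤n⇒∃[o]m+o≡n (*-cancelʳ-< 2 r m d<2m) = odd-isGap m r q eq
... | inj₂ (q , refl) with r , eq ← m≤n⇒∃[o]m+o≡n (*-cancelʳ-< 2 q m (<-trans (n<1+n (q * 2)) d<2m)) =
  even-isGap m q r eq

theorem1 : (n : ℕ) → 3 ≤ n → n % 2 ≡ 1 →
    Σ[ D ∈ NearHamiltonianDecomposition n ] Σ[ root ∈ Roots D ]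
    (RotationallySymmetric D root × Nomadic D root)
theorem1 n 3≤n n-odd = develop (n / 2) (trans (m≡m%n+[m/n]*n n 2) (cong (_+ n / 2 * 2) n-odd))
  where
  -- With `m` a variable, matching on `refl` replaces `n` by `suc (m * 2)` throughout the goal.
  develop : ∀ m → n ≡ suc (m * 2) → Σ[ D ∈ NearHamiltonianDecomposition n ] Σ[ root ∈ Roots D ]
            (RotationallySymmetric D root × Nomadic D root)
  develop m refl = decomposition , roots , rotationallySymmetric , nomadic
    where
    open Development (s≤s⁻¹ 3≤n) (zigzagℤ m) (zigzagℤ-injective m)
      (λ d → nonzero-isGap m (toℕ d) (toℕ<n d))
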